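{- Let $N\ge 3$ and let $v_a$ be any rim vertex of the wheel graph $W_{N+1}$ with central vertex $c$. Then $$\mathcal F_{W_{N+1}}(\{c,v_a\})=\tau(W_{N+1}/\{c,v_a\})=F_{2N}.$$
   Context: The wheel graph $W_{N+1}$ ($N\ge3$) has vertex set $\{c,v_1,\ldots,v_N\}$ and edges $\{v_i,v_{i+1}\}$ (indices modulo $N$) and $\{c,v_i\}$ for $1\le i\le N$; $c$ is the central vertex and the $v_i$ are the rim vertices. For a finite connected graph $G$ and $\varnothing\ne S\subseteq V(G)$, a rooted spanning forest of $G$ with root set $S$ is a spanning forest (an acyclic subgraph containing all vertices of $G$) in which each connected component contains exactly one vertex of $S$; $\mathcal F_G(S)$ denotes the number of such forests. $G/S$ is the multigraph obtained from $G$ by identifying all vertices of $S$ into a single vertex, keeping multiple edges with their multiplicities and deleting loops. $\tau(H)$ is the number of spanning trees of $H$, where parallel edges are regarded as distinct. Fibonacci numbers: $F_0=0$, $F_1=1$, $F_{n+2}=F_{n+1}+F_n$. -}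

module Defs where

open import Data.Fin.Base using (Fin; zero; suc; toℕ; fromℕ<)
import Data.Fin.Properties as Fin
open import Data.Fin.Subset using (Subset; inside; outside; _∈_)
open import Data.Fin.Subset.Properties using (_∈?_)
open import Data.List.Base
  using (List; []; _∷_; _++_; map; filter; length; lookup; allFin)
open import Data.List.Membership.Propositional using (find; lose) renaming (_∈_ to _∈ˡ_)
open import Data.List.Membership.Propositional.Properties
  using (∈-map⁺; ∈-allFin; ∈-lookup)
import Data.List.Membership.DecPropositional as DecMembership
import Data.List.Relation.Unary.All as All
open import Data.List.Relation.Unary.All.Properties using (¬Any⇒All¬)
open import Data.List.Relation.Unary.AllPairs using ([]; _∷_)
open import Data.List.Relation.Unary.Any as Any using (here; there)
open import Data.List.Relation.Unary.Any.Properties using (lookup-index)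
open import Data.List.Relation.Unary.Enumerates.Setoid using (IsEnumeration)
open import Data.List.Relation.Unary.Unique.Propositional using (Unique)
import Data.List.Relation.Unary.Unique.DecPropositional as DecUnique
open import Data.Maybe.Base using (Maybe; just; nothing)
import Data.Maybe.Properties as Maybe
open import Data.Nat.Base using (ℕ; zero; suc; _+_; _≤_; s≤s)
open import Data.Nat.DivMod using (_mod_)
open import Data.Irrelevant using ([_])
open import Data.Product.Base as Product
  using (Σ-syntax; ∃; ∃-syntax; _×_; _,_; proj₁; proj₂)
open import Data.Product using (∃!)
import Data.Product.Properties as Product
open import Data.Refinement using (Refinement; Refinement-syntax; _,_)
import Data.Refinement.Properties as Refinement
open import Data.Sum.Base using (_⊎_)
open import Data.Vec.Base using ([]; _∷_)
open import Function.Base using (_∘_)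
open import Function.Definitions using (Injective)
open import Relation.Binary.Definitions using (DecidableEquality)
open import Relation.Binary.PropositionalEquality
  using (_≡_; _≢_; refl; sym; trans; cong; subst; setoid)
open import Relation.Nullary.Decidable
  using (Dec; yes; no; ¬?; _×-dec_; _⊎-dec_; _→-dec_; map′)
open import Relation.Nullary.Negation using (¬_; contradiction)
open import Relation.Nullary.Recomputable using (¬-recompute)
open import Relation.Unary using (Decidable)

------------------------------------------------------------------------
-- Finite multigraphs

-- Parallel edges are repeated entries of `edges`, so an edge is a position
-- in that list.  The order of the two ends of an edge is irrelevant; see
-- `Joins`.  `vertices` may contain repetitions: it only witnesses finiteness.
record Multigraph : Set₁ where
  infix 4 _≟_
  field
    Vertex     : Set
    _≟_        : DecidableEquality Vertex
    vertices   : List Vertex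
    enumerates : IsEnumeration (setoid Vertex) vertices
    edges      : List (Vertex × Vertex)

  Edge : Set
  Edge = Fin (length edges)

  EdgeSet : Set
  EdgeSet = Subset (length edges)

  Joins : Edge → Vertex → Vertex → Set
  Joins e u v = lookup edges e ≡ (u , v) ⊎ lookup edges e ≡ (v , u)

open Multigraph using (Vertex; EdgeSet)

-- A set A of edges stands for the spanning subgraph with all vertices of G
-- and edge set A.
module Spanning (G : Multigraph) (A : EdgeSet G) where
  open Multigraph G hiding (EdgeSet; Vertex)

  private
    V : Set
    V = Vertex G

  data Walk : V → V → Set where
    []   : ∀ {u} → Walk u u
    step : ∀ {u v w} (e : Edge) → e ∈ A → Joins e u v → Walk v w → Walk u w

  edgesOf : ∀ {u v} → Walk u v → List Edge
  edgesOf []             = []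
  edgesOf (step e _ _ w) = e ∷ edgesOf w

  -- The starting vertex of every step, so the last vertex is left out.
  startsOf : ∀ {u v} → Walk u v → List V
  startsOf []                     = []
  startsOf (step {u = u} _ _ _ w) = u ∷ startsOf w

  -- Loops and pairs of parallel edges give cycles of length 1 and 2.
  IsCycle : ∀ {u} → Walk u u → Set
  IsCycle w = edgesOf w ≢ [] × Unique (edgesOf w) × Unique (startsOf w)

  Acyclic : Set
  Acyclic = ¬ (∃[ u ] Σ[ w ∈ Walk u u ] IsCycle w)

  Connected : Set
  Connected = ∀ u v → Walk u v

  IsSpanningTree : Set
  IsSpanningTree = Acyclic × Connected

  -- The component of v consists of the vertices reachable from v, and every
  -- component is the component of some v.
  IsRootedForest : List V → Set
  IsRootedForest S = Acyclic × (∀ v → ∃! _≡_ λ s → s ∈ˡ S × Walk v s)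

------------------------------------------------------------------------
-- Decidability, needed only to count: a walk without repeated starting
-- vertices has at most as many steps as there are vertices.

lookup-injective : ∀ {X : Set} {xs : List X} → Unique xs →
                   Injective _≡_ _≡_ (lookup xs)
lookup-injective (_ ∷ _) {zero} {zero} _ = refl
lookup-injective {xs = _ ∷ xs} (x∉ ∷ _) {zero} {suc j} eq =
  contradiction eq (All.lookup x∉ (∈-lookup {xs = xs} j))
lookup-injective {xs = _ ∷ xs} (x∉ ∷ _) {suc i} {zero} eq =
  contradiction (sym eq) (All.lookup x∉ (∈-lookup {xs = xs} i))
lookup-injective (_ ∷ u) {suc i} {suc j} eq =
  cong suc (lookup-injective u eq)

unique-length : ∀ {X : Set} {xs ys : List X} → IsEnumeration (setoid X) ys →
                Unique xs → length xs ≤ length ys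
unique-length {xs = xs} {ys} enum u =
  Fin.injective⇒≤ {f = λ i → Any.index (enum (lookup xs i))} λ {i} {j} eq →
    lookup-injective u
      (trans (lookup-index (enum (lookup xs i)))
      (trans (cong (lookup ys) eq)
             (sym (lookup-index (enum (lookup xs j))))))

module _ (G : Multigraph) where
  open Multigraph G hiding (EdgeSet; Vertex)
  open DecMembership _≟_ using () renaming (_∈?_ to _∈ˡ?_)

  private
    V : Set
    V = Vertex G

  joins? : ∀ e u v → Dec (Joins e u v)
  joins? e u v = lookup edges e ≟² (u , v) ⊎-dec lookup edges e ≟² (v , u)
    where _≟²_ = Product.≡-dec _≟_ _≟_

  ∃? : {P : V → Set} → Decidable P → Dec (∃ P)
  ∃? P? = map′ (λ a → let x , _ , p = find a in x , p)
               (λ (x , p) → lose (enumerates x) p)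
               (Any.any? P? vertices)

  ∀? : {P : V → Set} → Decidable P → Dec (∀ v → P v)
  ∀? P? = map′ (λ a v → All.lookup a (enumerates v))
               (λ f → All.tabulate λ {v} _ → f v)
               (All.all? P? vertices)

  module _ (A : EdgeSet G) where
    open Spanning G A

    walkOfLength? : ∀ {P : List Edge → List V → Set} →
                    (∀ es vs → Dec (P es vs)) → ∀ n u v →
                    Dec (Σ[ w ∈ Walk u v ] length (startsOf w) ≡ n ×
                                           P (edgesOf w) (startsOf w))
    walkOfLength? P? zero u v with u ≟ v
    ... | no u≢v  = no λ where ([] , _) → u≢v refl
    ... | yes refl with P? [] []
    ...   | yes p = yes ([] , refl , p)
    ...   | no ¬p = no λ where ([] , _ , p) → ¬p p
    walkOfLength? {P} P? (suc n) u v = map′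
      (λ (e , e∈A , x , j , w , l , p) → step e e∈A j w , cong suc l , p)
      (λ where (step e e∈A j w , refl , p) → e , e∈A , _ , j , w , refl , p)
      (Fin.any? λ e → e ∈? A ×-dec ∃? λ x → joins? e u x ×-dec
        walkOfLength? {P = λ es vs → P (e ∷ es) (u ∷ vs)}
                      (λ es vs → P? (e ∷ es) (u ∷ vs)) n x v)

    walk? : ∀ {P : List Edge → List V → Set} →
            (∀ es vs → Dec (P es vs)) →
            (∀ {es vs} → P es vs → Unique vs) → ∀ u v →
            Dec (Σ[ w ∈ Walk u v ] P (edgesOf w) (startsOf w))
    walk? {P} P? P⇒unique u v = map′
      (λ (_ , w , _ , p) → w , p)
      (λ (w , p) → let l<n = s≤s (unique-length enumerates (P⇒unique p)) in
         fromℕ< l<n , w , sym (Fin.toℕ-fromℕ< l<n) , p)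
      (Fin.any? {suc (length vertices)} λ i →
         walkOfLength? {P} P? (toℕ i) u v)

    dropTo : ∀ {u v x} (w : Walk u v) → x ∈ˡ startsOf w →
             Unique (startsOf w) → Σ[ w′ ∈ Walk x v ] Unique (startsOf w′)
    dropTo w@(step _ _ _ _) (here refl) un       = w , un
    dropTo (step _ _ _ w)   (there x∈w) (_ ∷ un) = dropTo w x∈w un

    toPath : ∀ {u v} → Walk u v → Σ[ w ∈ Walk u v ] Unique (startsOf w)
    toPath [] = [] , []
    toPath {u} (step e e∈A j w) with toPath w
    ... | w′ , un with u ∈ˡ? startsOf w′
    ...   | yes u∈w′ = dropTo w′ u∈w′ un
    ...   | no  u∉w′ = step e e∈A j w′ , ¬Any⇒All¬ _ u∉w′ ∷ un

    reachable? : ∀ u v → Dec (Walk u v)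
    reachable? u v = map′ proj₁ toPath
      (walk? {λ _ vs → Unique vs} (λ _ vs → DecUnique.unique? _≟_ vs)
             (λ un → un) u v)

    acyclic? : Dec Acyclic
    acyclic? = ¬? (∃? λ u →
      walk? {λ es vs → es ≢ [] × Unique es × Unique vs}
        (λ es vs → ¬? (nil? es) ×-dec DecUnique.unique? Fin._≟_ es
                                ×-dec DecUnique.unique? _≟_ vs)
        (proj₂ ∘ proj₂) u u)
      where
      nil? : (es : List Edge) → Dec (es ≡ [])
      nil? []      = yes refl
      nil? (_ ∷ _) = no λ ()

    ∃!? : {P : V → Set} → Decidable P → Dec (∃! _≡_ P)
    ∃!? P? = ∃? λ x → P? x ×-dec
      map′ (λ f {y} → f y) (λ f y → f {y}) (∀? λ y → P? y →-dec x ≟ y)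

    isSpanningTree? : Dec IsSpanningTree
    isSpanningTree? = acyclic? ×-dec ∀? λ u → ∀? λ v → reachable? u v

    isRootedForest? : ∀ S → Dec (IsRootedForest S)
    isRootedForest? S = acyclic? ×-dec
      ∀? λ v → ∃!? λ s → (s ∈ˡ? S) ×-dec reachable? v s

------------------------------------------------------------------------
-- Counting

subsets : ∀ n → List (Subset n)
subsets zero    = [] ∷ []
subsets (suc n) = map (inside ∷_) (subsets n) ++ map (outside ∷_) (subsets n)

count : ∀ {n} {P : Subset n → Set} → Decidable P → ℕ
count {n} P? = length (filter P? (subsets n))

-- The number of spanning trees.
τ : Multigraph → ℕ
τ G = count (isSpanningTree? G)

-- The number of rooted spanning forests whose root set is the set of
-- members of the given list.
𝓕 : (G : Multigraph) → List (Vertex G) → ℕ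
𝓕 G S = count λ A → isRootedForest? G A S

------------------------------------------------------------------------
-- Identifying the vertices of a set

module _ (G : Multigraph) (S : List (Vertex G)) where
  open Multigraph G hiding (EdgeSet; Vertex)
  open DecMembership _≟_ using (_∉_) renaming (_∈?_ to _∈ˡ?_)

  -- `nothing` is the vertex that the members of S are merged into.  (For
  -- empty S it would be a spurious isolated vertex.)
  MergedVertex : Set
  MergedVertex = Maybe [ v ∈ Vertex G ∣ v ∉ S ]

  merge : Vertex G → MergedVertex
  merge v with v ∈ˡ? S
  ... | yes _  = nothing
  ... | no v∉S = just (v , [ v∉S ])

  infix 4 _≟ᴹ_
  _≟ᴹ_ : DecidableEquality MergedVertex
  _≟ᴹ_ = Maybe.≡-dec (Refinement._≟_ _≟_)

  merge-just : (x : [ v ∈ Vertex G ∣ v ∉ S ]) →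
               merge (Refinement.value x) ≡ just x
  merge-just (v , [ v∉S ]) with v ∈ˡ? S
  ... | yes v∈S = contradiction v∈S (¬-recompute v∉S)
  ... | no _    = refl

  mergedVertices : List MergedVertex
  mergedVertices = nothing ∷ map merge vertices

  mergedVertices-enumerates : IsEnumeration (setoid MergedVertex) mergedVertices
  mergedVertices-enumerates nothing  = here refl
  mergedVertices-enumerates (just x) = there
    (subst (_∈ˡ map merge vertices) (merge-just x)
           (∈-map⁺ merge (enumerates (Refinement.value x))))

  infixl 7 _/_
  _/_ : Multigraph
  _/_ = record
    { Vertex     = MergedVertex
    ; _≟_        = _≟ᴹ_
    ; vertices   = mergedVertices
    ; enumerates = mergedVertices-enumerates
    ; edges      = filter (λ (u , v) → ¬? (u ≟ᴹ v))
                          (map (Product.map merge merge) edges)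
    }

------------------------------------------------------------------------
-- Wheel graphs

data WheelVertex (N : ℕ) : Set where
  centre : WheelVertex N
  rim    : Fin N → WheelVertex N

next : ∀ {N} → Fin N → Fin N
next {suc n} i = suc (toℕ i) mod suc n

rim-injective : ∀ {N} {i j : Fin N} → rim i ≡ rim j → i ≡ j
rim-injective refl = refl

_≟ᵂ_ : ∀ {N} → DecidableEquality (WheelVertex N)
centre ≟ᵂ centre = yes refl
centre ≟ᵂ rim _  = no λ ()
rim _  ≟ᵂ centre = no λ ()
rim i  ≟ᵂ rim j  = map′ (cong rim) rim-injective (i Fin.≟ j)

wheelVertices-enumerates : ∀ {N} →
  IsEnumeration (setoid (WheelVertex N)) (centre ∷ map rim (allFin N))
wheelVertices-enumerates centre  = here refl
wheelVertices-enumerates (rim i) = there (∈-map⁺ rim (∈-allFin i))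

-- The wheel with N rim vertices, i.e. the graph usually written W with
-- index N + 1.
wheel : ℕ → Multigraph
wheel N = record
  { Vertex     = WheelVertex N
  ; _≟_        = _≟ᵂ_
  ; vertices   = centre ∷ map rim (allFin N)
  ; enumerates = wheelVertices-enumerates
  ; edges      = map (λ i → rim i , rim (next i)) (allFin N)
              ++ map (λ i → centre , rim i) (allFin N)
  }

fib : ℕ → ℕ
fib zero          = 0
fib (suc zero)    = 1
fib (suc (suc n)) = fib (suc n) + fib n

{-# OPTIONS --safe #-}

-- Order the edges of a graph in a list.  A chosen sublist is acyclic iff no
-- edge has its two ends already linked by the chosen edges after it, and this
-- condition is invariant under permutation.  Hence identifying two vertices s
-- and r has the same effect as prepending an edge sr: both the forests of W
-- rooted at s and r and the spanning trees of W/{s,r} are the sublists L of the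
-- edges of W for which sr ∷ L is a spanning tree.
--
-- For the wheel, W/{c,v_a} is a fan over the path 1, …, N - 1 with apex 0, whose
-- two end spokes are doubled.  Let H_m be the fan over 1, …, m without the spoke
-- of 1 and with the extra edge from m to 0, and K_m the result of contracting 0
-- and 1 in it.  Deletion-contraction gives τ(H_{m+1}) = τ(K_m) + τ(H_m) and
-- τ(K_{m+1}) = 2 τ(K_m) + τ(H_m), so that τ(H_m) = F_{2m-1} and
-- τ(K_m) = F_{2m}; and W/{c,v_a} is K_N.

module Submission where

open import Defs
open import Algebra.Properties.CommutativeSemigroup using (interchange)
open import Data.Fin.Base using (Fin; zero; suc; toℕ; punchIn; pinch)
open import Data.Fin.Patterns using (0F; 1F; 2F)
open import Data.Fin.Properties
  using (toℕ-injective; toℕ-fromℕ<; toℕ<n; toℕ≤pred[n]; punchInᵢ≢i)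
open import Data.Fin.Subset using (Subset; inside; outside; _∈_)
open import Data.List.Base
  using (List; []; _∷_; _++_; map; filter; length; lookup; tabulate; allFin)
import Data.List.Membership.DecPropositional as DecMembership
open import Data.List.Membership.Propositional using () renaming (_∈_ to _∈ˡ_; _∉_ to _∉ˡ_)
open import Data.List.Membership.Propositional.Properties using (∈-map⁺; ∈-map⁻; ∈-allFin)
open import Data.List.Membership.Propositional.Properties.WithK using (unique∧set⇒bag)
open import Data.List.Properties
  using (filter-++; length-++; filter-accept; filter-reject; map-++; map-∘;
         map-cong; map-id-local; map-tabulate; tabulate-cong)
open import Data.List.Relation.Binary.BagAndSetEquality using (∼bag⇒↭)
open import Data.List.Relation.Binary.Permutation.Propositional
  using (_↭_; refl; prep; swap; ↭-sym; ↭-trans; ↭-reflexive) renaming (trans to ↭-step)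
open import Data.List.Relation.Binary.Permutation.Propositional.Properties
  using (∈-resp-↭; shift; ++⁺) renaming (map⁺ to map-↭)
open import Data.List.Relation.Binary.Subset.Propositional using (_⊆_)
open import Data.List.Relation.Unary.All as All using ([]; _∷_)
open import Data.List.Relation.Unary.All.Properties using (¬Any⇒All¬; All¬⇒¬Any; anti-mono)
open import Data.List.Relation.Unary.AllPairs using ([]; _∷_)
open import Data.List.Relation.Unary.Any using (here; there)
open import Data.List.Relation.Unary.Unique.Propositional using (Unique)
open import Data.List.Relation.Unary.Unique.Propositional.Properties using (map⁺; map⁻; allFin⁺)
open import Data.Maybe.Base using (just; nothing)
open import Data.Nat.Base using (ℕ; zero; suc; _+_; _*_; _∸_; _≤_; _<_; s≤s)
open import Data.Nat.DivMod
  using (_%_; _mod_; %-distribˡ-+; m%n%n≡m%n; [m+n]%n≡m%n; m<n⇒m%n≡m; n%n≡0)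
open import Data.Nat.Properties 
  using (+-identityʳ; +-comm; +-assoc; +-commutativeSemigroup; *-comm;
         m∸n+n≡m; m+[n∸m]≡n; <⇒≤; m≤n⇒m<n∨m≡n)
open import Data.Product.Base as Product using (Σ-syntax; ∃-syntax; _×_; _,_; proj₁; proj₂)
open import Data.Refinement using (value)
open import Data.Sum.Base using (inj₁; inj₂)
open import Data.Vec.Base using ([]; _∷_; here; there)
open import Function.Base using (_∘_; id; case_of_)
open import Function.Bundles using (_⇔_; mk⇔; Equivalence)
open import Relation.Binary.PropositionalEquality
  using (_≡_; _≢_; refl; sym; trans; cong; cong₂; subst; module ≡-Reasoning)
open import Relation.Binary.Structures using (IsEquivalence)
open import Relation.Nullary.Decidable using (yes; no)
open import Relation.Nullary.Negation using (¬_; contradiction)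
open import Relation.Unary using (Decidable)

open Equivalence using (to; from)

private
  variable
    V W X Y : Set

-- Forests and trees as lists of edges

-- Recursion on the list instead of on a walk: the head edge is either avoided or crossed once, in
-- one of two directions, and the parts before and after it use only the tail. Induction on the list
-- thus meets the head edge directly.
data Linked {V : Set} : List (V × V) → V → V → Set where
  []     : ∀ {u} → Linked [] u u
  skip   : ∀ {x L u v} → Linked L u v → Linked (x ∷ L) u v
  across : ∀ {a b L u v} → Linked L u a → Linked L b v → Linked ((a , b) ∷ L) u v
  back   : ∀ {a b L u v} → Linked L u b → Linked L a v → Linked ((a , b) ∷ L) u v

linked-refl : ∀ (L : List (V × V)) {u} → Linked L u u
linked-refl []      = []
linked-refl (_ ∷ L) = skip (linked-refl L)

linked-sym : ∀ {L : List (V × V)} {u v} → Linked L u v → Linked L v u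
linked-sym []           = []
linked-sym (skip p)     = skip (linked-sym p)
linked-sym (across p q) = back (linked-sym q) (linked-sym p)
linked-sym (back p q)   = across (linked-sym q) (linked-sym p)

-- If both links cross the head edge, the detour between the two crossings is dropped. Crossings in
-- the same direction leave one crossing, and crossings in opposite directions leave none.
linked-trans : ∀ {L : List (V × V)} {u v w} →
               Linked L u v → Linked L v w → Linked L u w
linked-trans []           []           = []
linked-trans (skip p)     (skip q)     = skip (linked-trans p q)
linked-trans (skip p)     (across q r) = across (linked-trans p q) r
linked-trans (skip p)     (back q r)   = back (linked-trans p q) r
linked-trans (across p q) (skip r)     = across p (linked-trans q r)
linked-trans (across p _) (across _ r) = across p r
linked-trans (across p _) (back _ r)   = skip (linked-trans p r)
linked-trans (back p q)   (skip r)     = back p (linked-trans q r)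
linked-trans (back p _)   (across _ r) = skip (linked-trans p r)
linked-trans (back p _)   (back _ r)   = back p r

linked-isEquivalence : (L : List (V × V)) → IsEquivalence (Linked L)
linked-isEquivalence L = record
  { refl = linked-refl L ; sym = linked-sym ; trans = linked-trans }

linked-edge : ∀ {L : List (V × V)} {u v} → (u , v) ∈ˡ L → Linked L u v
linked-edge (here refl) = across (linked-refl _) (linked-refl _)
linked-edge (there e)   = skip (linked-edge e)

module _ {E : V → V → Set} (isEquivalence : IsEquivalence E) where
  private module E = IsEquivalence isEquivalence

  -- Together with `linked-isEquivalence` and `linked-edge`, this makes `Linked L` the equivalence
  -- relation generated by the edges, hence independent of their order. Later facts about links
  -- follow by a suitable choice of `E`.
  linked-minimal : ∀ {L u v} → (∀ {a b} → (a , b) ∈ˡ L → E a b) →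
                   Linked L u v → E u v
  linked-minimal f []           = E.refl
  linked-minimal f (skip p)     = linked-minimal (f ∘ there) p
  linked-minimal f (across p q) =
    E.trans (linked-minimal (f ∘ there) p)
            (E.trans (f (here refl)) (linked-minimal (f ∘ there) q))
  linked-minimal f (back p q)   =
    E.trans (linked-minimal (f ∘ there) p)
            (E.trans (E.sym (f (here refl))) (linked-minimal (f ∘ there) q))

linked-mono : ∀ {L M : List (V × V)} {u v} → L ⊆ M → Linked L u v → Linked M u v
linked-mono L⊆M = linked-minimal (linked-isEquivalence _) (linked-edge ∘ L⊆M)

linked-resp-↭ : ∀ {L M : List (V × V)} {u v} → L ↭ M → Linked L u v → Linked M u v
linked-resp-↭ L↭M = linked-mono (∈-resp-↭ L↭M)

data IsForest {V : Set} : List (V × V) → Set where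
  []  : IsForest []
  _∷_ : ∀ {a b L} → ¬ Linked L a b → IsForest L → IsForest ((a , b) ∷ L)

-- A link between the ends of `y` that crosses `x` closes a cycle through both edges, and the same
-- cycle links the ends of `x` across `y`.
forest-swap : ∀ {x y} {L : List (V × V)} →
              IsForest (x ∷ y ∷ L) → IsForest (y ∷ x ∷ L)
forest-swap (¬ab ∷ ¬cd ∷ f) = ¬cd′ ∷ (¬ab ∘ skip) ∷ f
  where
  ¬cd′ : ¬ Linked _ _ _
  ¬cd′ (skip p)     = ¬cd p
  ¬cd′ (across p q) = ¬ab (across (linked-sym p) (linked-sym q))
  ¬cd′ (back p q)   = ¬ab (back q p)

forest-resp-↭ : ∀ {L M : List (V × V)} → L ↭ M → IsForest L → IsForest M
forest-resp-↭ refl         f        = f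
forest-resp-↭ (prep _ p)   (¬l ∷ f) =
  (¬l ∘ linked-resp-↭ (↭-sym p)) ∷ forest-resp-↭ p f
forest-resp-↭ (swap _ _ p) f with forest-swap f
... | ¬m ∷ ¬l ∷ g = (¬m ∘ linked-resp-↭ (prep _ (↭-sym p)))
                  ∷ (¬l ∘ linked-resp-↭ (↭-sym p)) ∷ forest-resp-↭ p g
forest-resp-↭ (↭-step p q) f        = forest-resp-↭ q (forest-resp-↭ p f)

IsTree : List (V × V) → Set
IsTree L = IsForest L × (∀ u v → Linked L u v)

tree-resp-↭ : ∀ {L M : List (V × V)} → L ↭ M → IsTree L → IsTree M
tree-resp-↭ p (f , c) = forest-resp-↭ p f , λ u v → linked-resp-↭ p (c u v)

-- Contraction of an edge as a map of vertices

mapEdges : (V → W) → List (V × V) → List (W × W)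
mapEdges φ = map (Product.map φ φ)

-- Characterises the quotient map that glues `a` to `b` and nothing else, without fixing the type of
-- the quotient. It covers the merged graph, the pinched fan and the unrolled wheel alike.
record Contracts {V W : Set} (a b : V) (φ : V → W) : Set where
  field
    proper     : a ≢ b
    identifies : φ a ≡ φ b
    fibres     : ∀ {u v} → φ u ≡ φ v → Linked ((a , b) ∷ []) u v
    surjective : ∀ w → ∃[ v ] φ v ≡ w

module _ {a b : V} {φ : V → W} (contracts : Contracts a b φ) where
  open Contracts contracts

  private
    -- Quantifying over all lifts makes this an equivalence relation: two lifts of one vertex are
    -- linked through the edge `ab`, and transitivity has a middle lift by surjectivity.
    Lifted : List (V × V) → W → W → Set
    Lifted L x y = ∀ {u v} → φ u ≡ x → φ v ≡ y → Linked ((a , b) ∷ L) u v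

    fibre : ∀ {L u v} → φ u ≡ φ v → Linked ((a , b) ∷ L) u v
    fibre eq = linked-mono (λ { (here refl) → here refl }) (fibres eq)

    lifted-isEquivalence : ∀ L → IsEquivalence (Lifted L)
    lifted-isEquivalence L = record
      { refl  = λ p q → fibre (trans p (sym q))
      ; sym   = λ f p q → linked-sym (f q p)
      ; trans = λ {_} {y} f g p q → let v , eq = surjective y in
                linked-trans (f p eq) (g eq q)
      }

  -- Minimality is applied twice: forwards to the pullback along `φ` of the links in the image,
  -- backwards to `Lifted L`.
  contract-linked : ∀ {L u v} →
    Linked ((a , b) ∷ L) u v ⇔ Linked (mapEdges φ L) (φ u) (φ v)
  contract-linked {L} = mk⇔
    (linked-minimal
      (record { refl = linked-refl _ ; sym = linked-sym ; trans = linked-trans })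
      λ where
        (here refl) → subst (Linked _ _) identifies (linked-refl _)
        (there e)   → linked-edge (∈-map⁺ _ e))
    (λ l → linked-minimal (lifted-isEquivalence L) edge l refl refl)
    where
    edge : ∀ {x y} → (x , y) ∈ˡ mapEdges φ L → Lifted L x y
    edge e p q with ∈-map⁻ _ e
    ... | _ , e′ , refl =
      linked-trans (fibre p) (linked-trans (linked-edge (there e′)) (fibre (sym q)))

  -- Moving `ab` behind the head edge brings it in front of the tail, where induction applies. For
  -- the head edge itself `contract-linked` decides.
  contract-forest : ∀ L → IsForest ((a , b) ∷ L) ⇔ IsForest (mapEdges φ L)
  contract-forest []      = mk⇔ (λ _ → []) (λ _ → (λ { [] → proper refl }) ∷ [])
  contract-forest (_ ∷ L) = mk⇔
    (carry ∘ forest-swap)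
    (λ { (¬l ∷ f) →
      forest-swap ((¬l ∘ to contract-linked) ∷ from (contract-forest L) f) })
    where
    carry : ∀ {c d} → IsForest ((c , d) ∷ (a , b) ∷ L) →
            IsForest (mapEdges φ ((c , d) ∷ L))
    carry (¬l ∷ f) = (¬l ∘ from contract-linked) ∷ to (contract-forest L) f

  contract-tree : ∀ L → IsTree ((a , b) ∷ L) ⇔ IsTree (mapEdges φ L)
  contract-tree L = mk⇔
    (λ (f , c) → to (contract-forest L) f , λ x y →
      let u , p = surjective x ; v , q = surjective y in
      subst (λ x → Linked _ x y) p
        (subst (Linked _ (φ u)) q (to contract-linked (c u v))))
    (λ (f , c) → from (contract-forest L) f , λ u v →
      from contract-linked (c (φ u) (φ v)))

-- Counting sublists

-- A relation rather than a function of Q, so that Q need not be decidable.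
data Counts {X : Set} (Q : List X → Set) : List X → ℕ → Set where
  accept : Q [] → Counts Q [] 1
  reject : ¬ Q [] → Counts Q [] 0
  branch : ∀ {x xs m n} → Counts (λ L → Q (x ∷ L)) xs m → Counts Q xs n →
           Counts Q (x ∷ xs) (m + n)

counts-cong : ∀ {Q R : List X → Set} {xs n} → (∀ L → Q L ⇔ R L) →
              Counts Q xs n → Counts R xs n
counts-cong e (accept q)   = accept (to (e _) q)
counts-cong e (reject ¬q)  = reject (¬q ∘ from (e _))
counts-cong e (branch c d) =
  branch (counts-cong (λ L → e (_ ∷ L)) c) (counts-cong e d)

counts-none : ∀ {Q : List X → Set} xs → (∀ {L} → L ⊆ xs → ¬ Q L) → Counts Q xs 0
counts-none []       ¬q = reject (¬q id)
counts-none (x ∷ xs) ¬q = branch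
  (counts-none xs λ L⊆ → ¬q λ { (here p) → here p ; (there p) → there (L⊆ p) })
  (counts-none xs λ L⊆ → ¬q (there ∘ L⊆))

counts-map⁺ : ∀ {Q : List Y → Set} {f : X → Y} {xs n} →
              Counts (Q ∘ map f) xs n → Counts Q (map f xs) n
counts-map⁺ (accept q)   = accept q
counts-map⁺ (reject ¬q)  = reject ¬q
counts-map⁺ (branch c d) = branch (counts-map⁺ c) (counts-map⁺ d)

counts-map⁻ : ∀ {Q : List Y → Set} {f : X → Y} xs {n} →
              Counts Q (map f xs) n → Counts (Q ∘ map f) xs n
counts-map⁻ []       (accept q)   = accept q
counts-map⁻ []       (reject ¬q)  = reject ¬q
counts-map⁻ (_ ∷ xs) (branch c d) = branch (counts-map⁻ xs c) (counts-map⁻ xs d)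

counts-resp-↭ : ∀ {Q : List X → Set} → (∀ {L M} → L ↭ M → Q L → Q M) →
                ∀ {xs ys n} → xs ↭ ys → Counts Q xs n → Counts Q ys n
counts-resp-↭ r refl         c            = c
counts-resp-↭ r (prep x p)   (branch c d) =
  branch (counts-resp-↭ (r ∘ prep x) p c) (counts-resp-↭ r p d)
-- The numbers `k`, `l`, `i`, `j` belong to the sublists with both `x` and `y`, with `x` only, with
-- `y` only and with neither. The swap exchanges `l` and `i`, and in the first class the invariance
-- of `Q` reorders `x` and `y`.
counts-resp-↭ r (swap x y p)
  (branch (branch {m = k} {n = l} c₁ c₂) (branch {m = i} {n = j} c₃ c₄)) =
  subst (Counts _ _) (interchange +-commutativeSemigroup k i l j)
    (branch
      (branch (counts-cong (λ L → mk⇔ (r (swap x y refl)) (r (swap y x refl)))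
                           (counts-resp-↭ (r ∘ prep x ∘ prep y) p c₁))
              (counts-resp-↭ (r ∘ prep y) p c₃))
      (branch (counts-resp-↭ (r ∘ prep x) p c₂) (counts-resp-↭ r p c₄)))
counts-resp-↭ r (↭-step p q) c            =
  counts-resp-↭ r q (counts-resp-↭ r p c)

counts-none⁻ : ∀ {Q : List X → Set} {xs n} → (∀ L → ¬ Q L) → Counts Q xs n → n ≡ 0
counts-none⁻ ¬q (accept q)   = contradiction q (¬q [])
counts-none⁻ ¬q (reject _)   = refl
counts-none⁻ ¬q (branch c d) =
  cong₂ _+_ (counts-none⁻ (λ L → ¬q (_ ∷ L)) c) (counts-none⁻ ¬q d)

-- An entry that fails `P` lies in no sublist satisfying `Q`, so the branch that takes it
-- contributes 0. This serves to discard loops.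
counts-filter : ∀ {P : X → Set} (P? : Decidable P) {Q : List X → Set} →
  (∀ {x L} → Q L → x ∈ˡ L → P x) → ∀ {xs n} →
  Counts Q xs n → Counts Q (filter P? xs) n
counts-filter P? q⇒p (accept q)  = accept q
counts-filter P? q⇒p (reject ¬q) = reject ¬q
counts-filter P? {Q} q⇒p (branch {x = x} {n = n} c d) with P? x
... | yes _ = branch (counts-filter P? (λ q → q⇒p q ∘ there) c) (counts-filter P? q⇒p d)
... | no ¬p = subst (λ m → Counts Q _ (m + n))
  (sym (counts-none⁻ (λ L q → ¬p (q⇒p q (here refl))) c)) (counts-filter P? q⇒p d)

-- Edge sets as sublists

select : (xs : List X) → Subset (length xs) → List X
select []       []            = []
select (x ∷ xs) (inside ∷ A)  = x ∷ select xs A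
select (x ∷ xs) (outside ∷ A) = select xs A

selected : ∀ (xs : List X) {A i} → i ∈ A → lookup xs i ∈ˡ select xs A
selected (_ ∷ _)                    here      = here refl
selected (_ ∷ xs) {A = inside ∷ _}  (there i) = there (selected xs i)
selected (_ ∷ xs) {A = outside ∷ _} (there i) = selected xs i

length-filter-map : ∀ {P : Y → Set} (P? : Decidable P) (f : X → Y) xs →
  length (filter P? (map f xs)) ≡ length (filter (P? ∘ f) xs)
length-filter-map P? f []       = refl
length-filter-map P? f (x ∷ xs) with P? (f x)
... | yes _ = cong suc (length-filter-map P? f xs)
... | no _  = length-filter-map P? f xs

-- `subsets` lists the sets containing the first position before the others, which is the split made
-- by `branch`.
count≡ : ∀ {Q : List X → Set} xs {n} {P : Subset (length xs) → Set}
         (P? : Decidable P) → (∀ A → P A ⇔ Q (select xs A)) →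
         Counts Q xs n → count P? ≡ n
count≡ [] P? e (accept q)  = cong length (filter-accept P? (from (e []) q))
count≡ [] P? e (reject ¬q) = cong length (filter-reject P? (¬q ∘ to (e [])))
count≡ (x ∷ xs) P? e (branch {m = m} {n = n} c d) = begin
  length (filter P? (map (inside ∷_) As ++ map (outside ∷_) As))
    ≡⟨ cong length (filter-++ P? (map (inside ∷_) As) _) ⟩
  length (filter P? (map (inside ∷_) As) ++ filter P? (map (outside ∷_) As))
    ≡⟨ length-++ (filter P? (map (inside ∷_) As)) ⟩
  length (filter P? (map (inside ∷_) As)) + length (filter P? (map (outside ∷_) As))
    ≡⟨ cong₂ _+_ (length-filter-map P? _ As) (length-filter-map P? _ As) ⟩
  count (P? ∘ (inside ∷_)) + count (P? ∘ (outside ∷_))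
    ≡⟨ cong₂ _+_ (count≡ xs _ (e ∘ (inside ∷_)) c) (count≡ xs _ (e ∘ (outside ∷_)) d) ⟩
  m + n ∎
  where
  open ≡-Reasoning
  As = subsets (length xs)

-- Deletion and contraction

-- The contraction half of deletion-contraction. As an equivalence it also trades the trees of the
-- merged graph for the sublists completed to a tree by `ab`.
counts-contract : ∀ {a b : V} {φ : V → W} → Contracts a b φ → ∀ es {n} →
  Counts IsTree (mapEdges φ es) n ⇔ Counts (λ L → IsTree ((a , b) ∷ L)) es n
counts-contract contracts es = mk⇔
  (λ c → counts-cong (λ L → mk⇔ (from (contract-tree contracts L)) (to (contract-tree contracts L)))
                     (counts-map⁻ es c))
  (λ c → counts-map⁺ (counts-cong (contract-tree contracts) c))

counts-loop : ∀ {a : V} {es n} → Counts IsTree es n → Counts IsTree ((a , a) ∷ es) n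
counts-loop = branch (counts-none _ λ { _ ((¬l ∷ _) , _) → ¬l (linked-refl _) })


forest-irreflexive : ∀ {L : List (V × V)} {u} → IsForest L → (u , u) ∉ˡ L
forest-irreflexive (¬l ∷ _) (here refl) = ¬l (linked-refl _)
forest-irreflexive (_ ∷ f)  (there e)   = forest-irreflexive f e

-- Spanning subgraphs as lists of edges

module _ (G : Multigraph) where
  open Multigraph G using (Vertex; _≟_; vertices; enumerates; edges)
  open DecMembership _≟_ using () renaming (_∈?_ to _∈ˡ?_)
  open Spanning using ([]; step)

  private
    Edges : Set
    Edges = List (Vertex × Vertex)

    -- Induction on the edges of G changes the graph but not its vertices.
    spannedBy : Edges → Multigraph
    spannedBy es = record
      { Vertex = Vertex ; _≟_ = _≟_ ; vertices = vertices
      ; enumerates = enumerates ; edges = es }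

    Walk : (es : Edges) → Subset (length es) → Vertex → Vertex → Set
    Walk es = Spanning.Walk (spannedBy es)

    edgesOf : ∀ {es A u v} → Walk es A u v → List (Fin (length es))
    edgesOf {es} {A} = Spanning.edgesOf (spannedBy es) A

    startsOf : ∀ {es A u v} → Walk es A u v → List Vertex
    startsOf {es} {A} = Spanning.startsOf (spannedBy es) A

    Acyclic : (es : Edges) → Subset (length es) → Set
    Acyclic es = Spanning.Acyclic (spannedBy es)

    Joins : (es : Edges) → Fin (length es) → Vertex → Vertex → Set
    Joins es = Multigraph.Joins (spannedBy es)

    -- In contrast to `startsOf`, the last vertex is included: a path that is to be closed by one
    -- more edge must not pass through its own end earlier.
    visitsOf : ∀ {es A u v} → Walk es A u v → List Vertex
    visitsOf {u = u} []             = u ∷ []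
    visitsOf {u = u} (step _ _ _ w) = u ∷ visitsOf w

    Path : (es : Edges) → Subset (length es) → Vertex → Vertex → Set
    Path es A u v = Σ[ w ∈ Walk es A u v ] Unique (visitsOf w)

  walk-trans : ∀ {es A u v w} → Walk es A u v → Walk es A v w → Walk es A u w
  walk-trans []             q = q
  walk-trans (step e a j p) q = step e a j (walk-trans p q)

  starts⊆visits : ∀ {es A u v} (w : Walk es A u v) → startsOf w ⊆ visitsOf w
  starts⊆visits (step _ _ _ w) (here eq) = here eq
  starts⊆visits (step _ _ _ w) (there i) = there (starts⊆visits w i)

  start∈visits : ∀ {es A u v} (w : Walk es A u v) → u ∈ˡ visitsOf w
  start∈visits []             = here refl
  start∈visits (step _ _ _ _) = here refl

  path-starts : ∀ {es A u v} (w : Walk es A u v) →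
                Unique (visitsOf w) → Unique (startsOf w)
  path-starts []             _        = []
  path-starts (step _ _ _ w) (x ∷ un) =
    anti-mono (starts⊆visits w) x ∷ path-starts w un

  end∈visits : ∀ {es A u v} (w : Walk es A u v) → v ∈ˡ visitsOf w
  end∈visits []             = here refl
  end∈visits (step _ _ _ w) = there (end∈visits w)

  path-end∉starts : ∀ {es A u v} (w : Walk es A u v) →
                    Unique (visitsOf w) → v ∉ˡ startsOf w
  path-end∉starts (step _ _ _ w) (x ∷ _)  (here refl) = All¬⇒¬Any x (end∈visits w)
  path-end∉starts (step _ _ _ w) (_ ∷ un) (there i)   = path-end∉starts w un i

  edge-end∈visits : ∀ {es A u v e x y} (w : Walk es A u v) →
                    e ∈ˡ edgesOf w → Joins es e x y → x ∈ˡ visitsOf w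
  edge-end∈visits (step _ _ (inj₁ p) w) (here refl) (inj₁ q) with trans (sym p) q
  ... | refl = here refl
  edge-end∈visits (step _ _ (inj₁ p) w) (here refl) (inj₂ q) with trans (sym p) q
  ... | refl = there (start∈visits w)
  edge-end∈visits (step _ _ (inj₂ p) w) (here refl) (inj₁ q) with trans (sym p) q
  ... | refl = there (start∈visits w)
  edge-end∈visits (step _ _ (inj₂ p) w) (here refl) (inj₂ q) with trans (sym p) q
  ... | refl = here refl
  edge-end∈visits (step _ _ _ w) (there i) j = there (edge-end∈visits w i j)

  -- An edge used a second time would put the starting vertex of its first use among the vertices
  -- visited afterwards.
  path-edges : ∀ {es A u v} (w : Walk es A u v) →
               Unique (visitsOf w) → Unique (edgesOf w)
  path-edges []             _        = []
  path-edges (step _ _ j w) (x ∷ un) =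
    ¬Any⇒All¬ _ (λ i → All¬⇒¬Any x (edge-end∈visits w i j)) ∷ path-edges w un

  path-from : ∀ {es A u v x} (w : Walk es A u v) → x ∈ˡ visitsOf w →
              Unique (visitsOf w) → Path es A x v
  path-from []               (here refl) un       = [] , un
  path-from w@(step _ _ _ _) (here refl) un       = w , un
  path-from (step _ _ _ w)   (there i)   (_ ∷ un) = path-from w i un

  -- Loop erasure: if the new starting vertex already lies on the path, the path is cut back to it.
  path : ∀ {es A u v} → Walk es A u v → Path es A u v
  path [] = [] , [] ∷ []
  path {u = u} (step e a j w) with path w
  ... | w′ , un with u ∈ˡ? visitsOf w′
  ...   | yes i = path-from w′ i un
  ...   | no ¬i = step e a j w′ , ¬Any⇒All¬ _ ¬i ∷ un

  walk⇒linked : ∀ {es A u v} → Walk es A u v → Linked (select es A) u v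
  walk⇒linked []                    = linked-refl _
  walk⇒linked {es} (step e a (inj₁ p) w) =
    linked-trans (linked-edge (subst (_∈ˡ _) p (selected es a))) (walk⇒linked w)
  walk⇒linked {es} (step e a (inj₂ p) w) =
    linked-trans (linked-sym (linked-edge (subst (_∈ˡ _) p (selected es a)))) (walk⇒linked w)

  weaken : ∀ {x es b A u v} → Walk es A u v → Walk (x ∷ es) (b ∷ A) u v
  weaken []             = []
  weaken (step e a j w) = step (suc e) (there a) j (weaken w)

  edgesOf-weaken : ∀ {x es b A u v} (w : Walk es A u v) →
                   edgesOf (weaken {x} {b = b} w) ≡ map suc (edgesOf w)
  edgesOf-weaken []             = refl
  edgesOf-weaken (step e _ _ w) = cong (suc e ∷_) (edgesOf-weaken w)

  startsOf-weaken : ∀ {x es b A u v} (w : Walk es A u v) →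
                    startsOf (weaken {x} {b = b} w) ≡ startsOf w
  startsOf-weaken []             = refl
  startsOf-weaken (step e _ _ w) = cong (_ ∷_) (startsOf-weaken w)

  linked⇒walk : ∀ es A {u v} → Linked (select es A) u v → Walk es A u v
  linked⇒walk []       []            []           = []
  linked⇒walk (_ ∷ es) (inside ∷ A)  (skip p)     = weaken (linked⇒walk es A p)
  linked⇒walk (_ ∷ es) (inside ∷ A)  (across p q) =
    walk-trans (weaken (linked⇒walk es A p))
               (step zero here (inj₁ refl) (weaken (linked⇒walk es A q)))
  linked⇒walk (_ ∷ es) (inside ∷ A)  (back p q)   =
    walk-trans (weaken (linked⇒walk es A p))
               (step zero here (inj₂ refl) (weaken (linked⇒walk es A q)))
  linked⇒walk (_ ∷ es) (outside ∷ A) p            = weaken (linked⇒walk es A p)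

  -- The walk counterpart of the constructors of `Linked`. The case `avoids` keeps track of the
  -- edges, so that distinctness and non-emptiness pass to the walk over the tail.
  data TrailCut {a b : Vertex} {es : Edges} (A : Subset (length es)) (u v : Vertex) :
                ∀ {s} → Walk ((a , b) ∷ es) (s ∷ A) u v → Set where
    avoids  : ∀ {s} {w : Walk ((a , b) ∷ es) (s ∷ A) u v} (w′ : Walk es A u v) →
              edgesOf w ≡ map suc (edgesOf w′) → TrailCut A u v w
    along   : ∀ {w : Walk ((a , b) ∷ es) (inside ∷ A) u v} →
              Walk es A u a → Walk es A b v → TrailCut A u v w
    against : ∀ {w : Walk ((a , b) ∷ es) (inside ∷ A) u v} →
              Walk es A u b → Walk es A a v → TrailCut A u v w

  strengthen : ∀ {x es s A u v} (w : Walk (x ∷ es) (s ∷ A) u v) → zero ∉ˡ edgesOf w →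
               Σ[ w′ ∈ Walk es A u v ] edgesOf w ≡ map suc (edgesOf w′)
  strengthen []                         _  = [] , refl
  strengthen (step zero _ _ _)          ¬i = contradiction (here refl) ¬i
  strengthen (step (suc e) (there a) j w) ¬i with strengthen w (¬i ∘ there)
  ... | w′ , eq = step e a j w′ , cong (suc e ∷_) eq

  trail-cut : ∀ {a b es s A u v} (w : Walk ((a , b) ∷ es) (s ∷ A) u v) →
              Unique (edgesOf w) → TrailCut A u v w
  trail-cut [] _ = avoids [] refl
  trail-cut (step zero here (inj₁ refl) w) (x ∷ _) =
    along [] (proj₁ (strengthen w (All¬⇒¬Any x)))
  trail-cut (step zero here (inj₂ refl) w) (x ∷ _) =
    against [] (proj₁ (strengthen w (All¬⇒¬Any x)))
  trail-cut (step (suc e) (there i) j w) (_ ∷ un) with trail-cut w un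
  ... | avoids w′ eq = avoids (step e i j w′) (cong (suc e ∷_) eq)
  ... | along p q    = along (step e i j p) q
  ... | against p q  = against (step e i j p) q

  -- A closed trail through the head edge would link the two ends of that edge within the tail. A
  -- closed trail avoiding it lives in the tail, where induction applies.
  forest-no-trail : ∀ es A → IsForest (select es A) → ∀ {u} (w : Walk es A u u) →
                    edgesOf w ≢ [] → ¬ Unique (edgesOf w)
  forest-no-trail [] A f [] ne _ = ne refl
  forest-no-trail (_ ∷ es) (s ∷ A) f w ne un with trail-cut w un
  forest-no-trail (_ ∷ es) (inside ∷ A) (¬l ∷ f) w ne un | avoids w′ eq =
    forest-no-trail es A f w′ (ne ∘ trans eq ∘ cong (map suc)) (map⁻ (subst Unique eq un))
  forest-no-trail (_ ∷ es) (outside ∷ A) f w ne un | avoids w′ eq =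
    forest-no-trail es A f w′ (ne ∘ trans eq ∘ cong (map suc)) (map⁻ (subst Unique eq un))
  forest-no-trail (_ ∷ es) (inside ∷ A) (¬l ∷ _) w ne un | along p q =
    ¬l (linked-sym (linked-trans (walk⇒linked q) (walk⇒linked p)))
  forest-no-trail (_ ∷ es) (inside ∷ A) (¬l ∷ _) w ne un | against p q =
    ¬l (linked-trans (walk⇒linked q) (walk⇒linked p))

  acyclic⇒forest : ∀ es A → Acyclic es A → IsForest (select es A)
  acyclic⇒forest []             []      _  = []
  acyclic⇒forest ((a , b) ∷ es) (s ∷ A) ac = extend s ac
    where
    tail : ∀ {s} → Acyclic ((a , b) ∷ es) (s ∷ A) → Acyclic es A
    tail ac (u , w , ne , un-e , un-s) = ac
      ( u , weaken w
      , (λ eq → ne (map-[] (trans (sym (edgesOf-weaken w)) eq)))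
      , subst Unique (sym (edgesOf-weaken w)) (map⁺ (λ { refl → refl }) un-e)
      , subst Unique (sym (startsOf-weaken w)) un-s )
      where
      map-[] : ∀ {xs : List (Fin (length es))} → map Fin.suc xs ≡ [] → xs ≡ []
      map-[] {[]} _ = refl

    extend : ∀ s → Acyclic ((a , b) ∷ es) (s ∷ A) → IsForest (select ((a , b) ∷ es) (s ∷ A))
    extend outside ac = acyclic⇒forest es A (tail ac)
    extend inside  ac = closes ∷ acyclic⇒forest es A (tail ac)
      where
      closes : ¬ Linked (select es A) a b
      closes l with path (linked⇒walk es A l)
      ... | w , un = ac
        -- The cycle goes from `b` over the new edge to `a` and returns along the path. Its starting
        -- vertices are distinct because `b` is the end of the path, not one of its starts.
        ( b , step zero here (inj₂ refl) (weaken w) , (λ ())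
        , subst (Unique ∘ (zero ∷_)) (sym (edgesOf-weaken w))
            (¬Any⇒All¬ _ zero∉ ∷ map⁺ (λ { refl → refl }) (path-edges w un))
        , subst (Unique ∘ (b ∷_)) (sym (startsOf-weaken w))
            (¬Any⇒All¬ _ (path-end∉starts w un) ∷ path-starts w un) )
        where
        zero∉ : zero ∉ˡ map suc (edgesOf w)
        zero∉ i with ∈-map⁻ suc i
        ... | _ , _ , ()

  acyclic⇔forest : ∀ A → Acyclic edges A ⇔ IsForest (select edges A)
  acyclic⇔forest A = mk⇔ (acyclic⇒forest edges A)
    λ f (u , w , ne , un , _) → forest-no-trail edges A f w ne un

  spanningTree⇔tree : ∀ A → Spanning.IsSpanningTree G A ⇔ IsTree (select edges A)
  spanningTree⇔tree A = mk⇔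
    (λ (ac , c) → to (acyclic⇔forest A) ac , λ u v → walk⇒linked (c u v))
    (λ (f , c) → from (acyclic⇔forest A) f , λ u v → linked⇒walk edges A (c u v))

  -- The edge `sr` joins the component of `s` to that of `r`. Uniqueness of the root of `s` says
  -- that `s` and `r` are not linked before, so no cycle arises.
  rootedForest⇔tree : ∀ {s r} → s ≢ r → ∀ A →
    Spanning.IsRootedForest G A (s ∷ r ∷ []) ⇔ IsTree ((s , r) ∷ select edges A)
  rootedForest⇔tree {s} {r} s≢r A = mk⇔
    (λ (ac , rooted) →
      let s-root = proj₂ (proj₂ (rooted s))
          ¬sr : ¬ Linked (select edges A) s r
          ¬sr l = s≢r (trans (sym (s-root (here refl , [])))
                             (s-root (there (here refl) , linked⇒walk edges A l)))
          reach : ∀ v → Linked ((s , r) ∷ select edges A) v s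
          reach v = toRoot (proj₂ (rooted v))
      in ¬sr ∷ to (acyclic⇔forest A) ac
       , λ u v → linked-trans (reach u) (linked-sym (reach v)))
    (λ { (¬sr ∷ f , c) → from (acyclic⇔forest A) f , λ v → root ¬sr (c v s) })
    where
    toRoot : ∀ {v x} {Z : Set} → (x ∈ˡ (s ∷ r ∷ []) × Spanning.Walk G A v x) × Z →
             Linked ((s , r) ∷ select edges A) v s
    toRoot ((here refl , w) , _)         = skip (walk⇒linked w)
    toRoot ((there (here refl) , w) , _) = back (walk⇒linked w) (linked-refl _)

    Root : Vertex → Vertex → Set
    Root v x = x ∈ˡ (s ∷ r ∷ []) × Spanning.Walk G A v x

    at-s : ¬ Linked (select edges A) s r → ∀ {v} → Linked (select edges A) v s →
           ∃[ x ] Root v x × (∀ {y} → Root v y → x ≡ y)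
    at-s ¬sr l = s , (here refl , linked⇒walk edges A l) , λ where
      (here refl , w)         → refl
      (there (here refl) , w) →
        contradiction (linked-trans (linked-sym l) (walk⇒linked w)) ¬sr

    at-r : ¬ Linked (select edges A) s r → ∀ {v} → Linked (select edges A) v r →
           ∃[ x ] Root v x × (∀ {y} → Root v y → x ≡ y)
    at-r ¬sr l = r , (there (here refl) , linked⇒walk edges A l) , λ where
      (here refl , w)         →
        contradiction (linked-trans (linked-sym (walk⇒linked w)) l) ¬sr
      (there (here refl) , w) → refl

    root : ¬ Linked (select edges A) s r → ∀ {v} →
           Linked ((s , r) ∷ select edges A) v s →
           ∃[ x ] Root v x × (∀ {y} → Root v y → x ≡ y)
    -- The part of the link before it crosses `sr`, or all of it if it does not, ends at the root of
    -- `v`.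
    root ¬sr (skip p)     = at-s ¬sr p
    root ¬sr (across p _) = at-s ¬sr p
    root ¬sr (back p _)   = at-r ¬sr p

-- Merging two vertices

merge-contracts : (G : Multigraph) {s r : Multigraph.Vertex G} → s ≢ r →
                  Contracts s r (merge G (s ∷ r ∷ []))
merge-contracts G {s} {r} s≢r = record
  { proper     = s≢r
  ; identifies = trans (merge-member (here refl)) (sym (merge-member (there (here refl))))
  ; fibres     = fibres
  ; surjective = λ where
      nothing  → s , merge-member (here refl)
      (just x) → value x , merge-just G S x
  }
  where
  open Multigraph G using (_≟_)
  open DecMembership _≟_ using () renaming (_∈?_ to _∈ˡ?_)

  S = s ∷ r ∷ []

  merge-member : ∀ {v} → v ∈ˡ S → merge G S v ≡ nothing
  merge-member {v} v∈S with v ∈ˡ? S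
  ... | yes _  = refl
  ... | no v∉S = contradiction v∈S v∉S

  joined : ∀ {u v} → u ∈ˡ S → v ∈ˡ S → Linked ((s , r) ∷ []) u v
  joined (here refl)         (here refl)         = linked-refl _
  joined (here refl)         (there (here refl)) = across [] []
  joined (there (here refl)) (here refl)         = back [] []
  joined (there (here refl)) (there (here refl)) = linked-refl _

  fibres : ∀ {u v} → merge G S u ≡ merge G S v → Linked ((s , r) ∷ []) u v
  fibres {u} {v} eq with u ∈ˡ? S | v ∈ˡ? S
  ... | yes u∈S | yes v∈S = joined u∈S v∈S
  fibres refl | no _ | no _ = linked-refl _

module _ (G : Multigraph) {s r : Multigraph.Vertex G} (s≢r : s ≢ r) {n : ℕ}
         (c : Counts (λ L → IsTree ((s , r) ∷ L)) (Multigraph.edges G) n) where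

  𝓕-counted : 𝓕 G (s ∷ r ∷ []) ≡ n
  𝓕-counted = count≡ (Multigraph.edges G) (λ A → isRootedForest? G A (s ∷ r ∷ []))
              (rootedForest⇔tree G s≢r) c

  τ-merged-counted : τ (G / (s ∷ r ∷ [])) ≡ n
  τ-merged-counted = count≡ (Multigraph.edges G/S) (isSpanningTree? G/S) (spanningTree⇔tree G/S)
    -- The quotient graph omits the loops created by merging. No forest contains a loop, so the
    -- count is unaffected.
    (counts-filter _ (λ { (f , _) e refl → forest-irreflexive f e })
      (from (counts-contract (merge-contracts G s≢r) (Multigraph.edges G)) c))
    where G/S = G / (s ∷ r ∷ [])

-- The fan

mapEdges-id : ∀ {f : V → V} → (∀ v → f v ≡ v) → ∀ L → mapEdges f L ≡ L
mapEdges-id f-id = map-id-local ∘ All.universal (λ (u , v) → cong₂ _,_ (f-id u) (f-id v))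

toℕ-next : ∀ {n} (i : Fin (suc n)) → toℕ (next i) ≡ suc (toℕ i) % suc n
toℕ-next i = toℕ-fromℕ< _

next-last : ∀ {n} (i : Fin (suc n)) → toℕ i ≡ n → next i ≡ zero
next-last {n} i eq = toℕ-injective (trans (toℕ-next i)
  (trans (cong (λ k → suc k % suc n) eq) (n%n≡0 (suc n))))

toℕ-next-< : ∀ {n} (i : Fin (suc n)) → toℕ i < n → toℕ (next i) ≡ suc (toℕ i)
toℕ-next-< i i<n = trans (toℕ-next i) (m<n⇒m%n≡m (s≤s i<n))

toℕ-punchIn-1 : ∀ {n} (i : Fin (suc n)) {k} → toℕ i ≡ suc k →
                toℕ (punchIn (suc zero) i) ≡ suc (suc k)
toℕ-punchIn-1 (suc i) eq = cong suc eq

-- `punchIn 1F` fixes 0 and shifts all other positions by one, so it respects both the wrap-around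
-- to 0 and the ordinary steps.
next-suc : ∀ {n} (i : Fin (suc n)) → next (suc i) ≡ punchIn (suc zero) (next i)
next-suc {n} i with m≤n⇒m<n∨m≡n (toℕ≤pred[n] i)
... | inj₁ i<n = toℕ-injective (trans (toℕ-next-< (suc i) (s≤s i<n))
                   (sym (toℕ-punchIn-1 (next i) (toℕ-next-< i i<n))))
... | inj₂ i≡n = trans (next-last (suc i) (cong suc i≡n))
                   (cong (punchIn (suc zero)) (sym (next-last i i≡n)))

-- In the notation above, fan k is H_{k+1}, and its image under pinch 0F is K_{k+1}.
rim-edge : ∀ k → Fin (1 + k) → Fin (2 + k) × Fin (2 + k)
rim-edge k j = suc j , next (suc j)

spoke : ∀ k → Fin k → Fin (2 + k) × Fin (2 + k)
spoke k j = 0F , suc (suc j)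

rims spokes fan : ∀ k → List (Fin (2 + k) × Fin (2 + k))
rims k   = tabulate (rim-edge k)
spokes k = tabulate (spoke k)
fan k    = rims k ++ spokes k

rims-suc : ∀ k → rims (suc k) ≡ (1F , 2F) ∷ mapEdges (punchIn 1F) (rims k)
rims-suc k = cong ((1F , 2F) ∷_) (trans
  (tabulate-cong λ j → cong (suc (suc j) ,_) (next-suc (suc j)))
  (sym (map-tabulate (rim-edge k) (Product.map (punchIn 1F) (punchIn 1F)))))

spokes-suc : ∀ k → spokes (suc k) ≡ (0F , 2F) ∷ mapEdges (punchIn 1F) (spokes k)
spokes-suc k = cong ((0F , 2F) ∷_) (sym (map-tabulate (spoke k) _))

-- The fan grows at its open end: the old vertex 1 is renumbered 2, receives a spoke and is joined
-- to a new vertex 1.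
fan-suc : ∀ k → fan (suc k) ↭ (1F , 2F) ∷ (0F , 2F) ∷ mapEdges (punchIn 1F) (fan k)
fan-suc k = ↭-trans (↭-reflexive (cong₂ _++_ (rims-suc k) (spokes-suc k)))
  (prep _ (↭-trans (shift (0F , 2F) (mapEdges (punchIn 1F) (rims k)) _)
    (prep _ (↭-reflexive (sym (map-++ _ (rims k) (spokes k)))))))

contract-01 : ∀ {n} → Contracts {Fin (2 + n)} 0F 1F (pinch 0F)
contract-01 = record
  { proper     = λ ()
  ; identifies = refl
  ; fibres     = fibres _ _
  ; surjective = λ v → suc v , refl
  }
  where
  fibres : ∀ u v → pinch 0F u ≡ pinch 0F v → Linked ((0F , 1F) ∷ []) u v
  fibres 0F      0F      _    = linked-refl _
  fibres 0F      (suc v) refl = across [] []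
  fibres (suc u) 0F      refl = back [] []
  fibres (suc u) (suc v) refl = linked-refl _

contract-12 : ∀ {n} → Contracts {Fin (3 + n)} 1F 2F (pinch 1F)
contract-12 = record
  { proper     = λ ()
  ; identifies = refl
  ; fibres     = fibres _ _
  ; surjective = λ where
      0F      → 0F , refl
      (suc v) → suc (suc v) , refl
  }
  where
  fibres : ∀ u v → pinch 1F u ≡ pinch 1F v → Linked ((1F , 2F) ∷ []) u v
  fibres 0F            0F            _    = linked-refl _
  fibres 1F            1F            _    = linked-refl _
  fibres 1F            (suc (suc v)) refl = across [] []
  fibres (suc (suc u)) 1F            refl = back [] []
  fibres (suc (suc u)) (suc (suc v)) refl = linked-refl _

-- The deletion-contraction recursion for the fan

counts-branch : ∀ {a b : V} {φ : V → W} {es m n} → Contracts a b φ →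
  Counts IsTree (mapEdges φ es) m → Counts IsTree es n →
  Counts IsTree ((a , b) ∷ es) (m + n)
counts-branch contracts c d = branch (to (counts-contract contracts _) c) d

-- "Both or neither equal `x`" is an equivalence relation that contains every edge, so by minimality
-- no link leaves `x`.
counts-isolated : ∀ {x y : V} → x ≢ y → ∀ {es} →
  (∀ {a b} → (a , b) ∈ˡ es → a ≢ x × b ≢ x) → Counts IsTree es 0
counts-isolated {x = x} {y} x≢y avoid = counts-none _ λ L⊆es (_ , c) →
  x≢y (sym (proj₁ (linked-minimal same-side
    (λ e → let a≢x , b≢x = avoid (L⊆es e) in
           (λ a≡x → contradiction a≡x a≢x) , (λ b≡x → contradiction b≡x b≢x))
    (c x y)) refl))
  where
  same-side : IsEquivalence (λ u v → (u ≡ x → v ≡ x) × (v ≡ x → u ≡ x))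
  same-side = record
    { refl  = id , id
    ; sym   = λ (f , g) → g , f
    ; trans = λ (f , g) (h , k) → h ∘ f , g ∘ k
    }

private
  pinch-0∘punchIn-1 : ∀ {n} (i : Fin (suc n)) → pinch 0F (punchIn 1F i) ≡ i
  pinch-0∘punchIn-1 0F      = refl
  pinch-0∘punchIn-1 (suc i) = refl

  pinch-1∘punchIn-1 : ∀ {n} (i : Fin (2 + n)) → pinch 1F (punchIn 1F i) ≡ i
  pinch-1∘punchIn-1 0F      = refl
  pinch-1∘punchIn-1 (suc i) = refl

  retract : ∀ {φ : V → W} {ψ : W → V} → (∀ w → φ (ψ w) ≡ w) → ∀ L →
            mapEdges φ (mapEdges ψ L) ≡ L
  retract eq L = trans (sym (map-∘ L)) (mapEdges-id eq L)

mutual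
  -- In the larger fan vertex 1 hangs on the edge to 2 alone. Deleting that edge isolates 1, and
  -- contracting it leaves the smaller fan with a spoke added at 1.
  counts-fan : ∀ k → Counts IsTree (fan k) (fib (suc (k * 2)))
  counts-fan zero = branch
    (accept ((λ { () }) ∷ [] , λ where
      0F 0F → linked-refl _
      0F 1F → back [] []
      1F 0F → across [] []
      1F 1F → linked-refl _))
    (reject λ (_ , c) → case c 0F 1F of λ ())
  counts-fan (suc k) =
    counts-resp-↭ tree-resp-↭ (↭-sym (fan-suc k))
      (subst (Counts IsTree _) (+-identityʳ _)
        (counts-branch contract-12
          (subst (λ es → Counts IsTree ((0F , 1F) ∷ es) (fib (3 + k * 2)))
                 (sym (retract pinch-1∘punchIn-1 (fan k))) (counts-spoke∷fan k))
          (counts-isolated {x = 1F} {0F} (λ ()) λ where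
            (here refl) → (λ ()) , (λ ())
            (there e)   → avoid e)))
    where
    avoid : ∀ {a b} → (a , b) ∈ˡ mapEdges (punchIn 1F) (fan k) → a ≢ 1F × b ≢ 1F
    avoid e with ∈-map⁻ _ {xs = fan k} e
    ... | (i , j) , _ , refl = punchInᵢ≢i 1F i , punchInᵢ≢i 1F j

  -- Gluing 1 to 0 turns the edges from 1 and from 0 to 2 into two parallel spokes, in front of the
  -- smaller fan.
  counts-pinched-fan : ∀ k → Counts IsTree (mapEdges (pinch 0F) (fan k)) (fib (suc (suc (k * 2))))
  counts-pinched-fan zero    = counts-loop (accept ([] , λ { 0F 0F → [] }))
  counts-pinched-fan (suc k) =
    counts-resp-↭ tree-resp-↭ (map-↭ _ (↭-sym (fan-suc k)))
      (subst (λ es → Counts IsTree ((0F , 1F) ∷ (0F , 1F) ∷ es) (fib (4 + k * 2)))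
             (sym (retract pinch-0∘punchIn-1 (fan k))) (counts-two-spokes∷fan k))

  counts-spoke∷fan : ∀ k → Counts IsTree ((0F , 1F) ∷ fan k) (fib (3 + k * 2))
  counts-spoke∷fan k = counts-branch contract-01 (counts-pinched-fan k) (counts-fan k)

  -- Contracting one of the parallel spokes makes the other a loop, and deleting it leaves a single
  -- spoke.
  counts-two-spokes∷fan : ∀ k →
    Counts IsTree ((0F , 1F) ∷ (0F , 1F) ∷ fan k) (fib (4 + k * 2))
  counts-two-spokes∷fan k = subst (Counts IsTree _) (+-comm (fib (2 + k * 2)) _)
    (counts-branch contract-01 (counts-loop (counts-pinched-fan k)) (counts-spoke∷fan k))

-- Contracting the wheel to a fan

module _ {n : ℕ} where
  private
    N = suc n

  %-absorb : ∀ i j → (i % N + j) % N ≡ (i + j) % N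
  %-absorb i j = begin
    (i % N + j) % N             ≡⟨ %-distribˡ-+ (i % N) j N ⟩
    (i % N % N + j % N) % N     ≡⟨ cong (λ k → (k + j % N) % N) (m%n%n≡m%n i N) ⟩
    (i % N + j % N) % N         ≡⟨ %-distribˡ-+ i j N ⟨
    (i + j) % N                 ∎
    where open ≡-Reasoning

  rotate : ℕ → Fin N → Fin N
  rotate r i = (toℕ i + r) mod N

  toℕ-rotate : ∀ r i → toℕ (rotate r i) ≡ (toℕ i + r) % N
  toℕ-rotate r i = toℕ-fromℕ< _

  rotate-inverse : ∀ {r s} → r + s ≡ N → ∀ i → rotate s (rotate r i) ≡ i
  rotate-inverse {r} {s} r+s≡N i = toℕ-injective (begin
    toℕ (rotate s (rotate r i))   ≡⟨ toℕ-rotate s (rotate r i) ⟩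
    (toℕ (rotate r i) + s) % N    ≡⟨ cong (λ k → (k + s) % N) (toℕ-rotate r i) ⟩
    ((toℕ i + r) % N + s) % N     ≡⟨ %-absorb (toℕ i + r) s ⟩
    (toℕ i + r + s) % N           ≡⟨ cong (_% N) (+-assoc (toℕ i) r s) ⟩
    (toℕ i + (r + s)) % N         ≡⟨ cong (λ k → (toℕ i + k) % N) r+s≡N ⟩
    (toℕ i + N) % N               ≡⟨ [m+n]%n≡m%n (toℕ i) N ⟩
    toℕ i % N                     ≡⟨ m<n⇒m%n≡m (toℕ<n i) ⟩
    toℕ i                         ∎)
    where open ≡-Reasoning

  rotate-next : ∀ r i → rotate r (next i) ≡ next (rotate r i)
  rotate-next r i = toℕ-injective (begin
    toℕ (rotate r (next i))       ≡⟨ toℕ-rotate r (next i) ⟩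
    (toℕ (next i) + r) % N        ≡⟨ cong (λ k → (k + r) % N) (toℕ-next i) ⟩
    (suc (toℕ i) % N + r) % N     ≡⟨ %-absorb (suc (toℕ i)) r ⟩
    suc (toℕ i + r) % N           ≡⟨ cong (_% N) (+-comm 1 (toℕ i + r)) ⟩
    (toℕ i + r + 1) % N           ≡⟨ %-absorb (toℕ i + r) 1 ⟨
    ((toℕ i + r) % N + 1) % N     ≡⟨ cong (_% N) (+-comm _ 1) ⟩
    suc ((toℕ i + r) % N) % N     ≡⟨ cong (λ k → suc k % N) (toℕ-rotate r i) ⟨
    suc (toℕ (rotate r i)) % N    ≡⟨ toℕ-next (rotate r i) ⟨
    toℕ (next (rotate r i))       ∎)
    where open ≡-Reasoning

  module _ (a : Fin N) where
    private
      ψ ψ⁻¹ : Fin N → Fin N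
      ψ   = rotate (N ∸ toℕ a)
      ψ⁻¹ = rotate (toℕ a)

      ψ⁻¹∘ψ : ∀ i → ψ⁻¹ (ψ i) ≡ i
      ψ⁻¹∘ψ = rotate-inverse (m∸n+n≡m (<⇒≤ (toℕ<n a)))

      ψ∘ψ⁻¹ : ∀ j → ψ (ψ⁻¹ j) ≡ j
      ψ∘ψ⁻¹ = rotate-inverse (m+[n∸m]≡n (<⇒≤ (toℕ<n a)))

      ψ-injective : ∀ {i j} → ψ i ≡ ψ j → i ≡ j
      ψ-injective {i} {j} eq = trans (sym (ψ⁻¹∘ψ i)) (trans (cong ψ⁻¹ eq) (ψ⁻¹∘ψ j))

      ψa≡0 : ψ a ≡ zero
      ψa≡0 = toℕ-injective (begin
        toℕ (ψ a)                     ≡⟨ toℕ-rotate (N ∸ toℕ a) a ⟩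
        (toℕ a + (N ∸ toℕ a)) % N     ≡⟨ cong (_% N) (m+[n∸m]≡n (<⇒≤ (toℕ<n a))) ⟩
        N % N                         ≡⟨ n%n≡0 N ⟩
        0                             ∎)
        where open ≡-Reasoning

    -- Positions along the rim counted from a; the merged vertex is 0.
    unroll : WheelVertex N → Fin N
    unroll centre  = zero
    unroll (rim i) = ψ i

    unroll-contracts : Contracts centre (rim a) unroll
    unroll-contracts = record
      { proper     = λ ()
      ; identifies = sym ψa≡0
      ; fibres     = fibres
      ; surjective = λ j → rim (ψ⁻¹ j) , ψ∘ψ⁻¹ j
      }
      where
      fibres : ∀ {u v} → unroll u ≡ unroll v → Linked ((centre , rim a) ∷ []) u v
      fibres {centre} {centre} _  = linked-refl _
      fibres {centre} {rim i}  eq with ψ-injective {a} {i} (trans ψa≡0 eq)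
      ... | refl = across [] []
      fibres {rim i}  {centre} eq with ψ-injective {a} {i} (trans ψa≡0 (sym eq))
      ... | refl = back [] []
      fibres {rim i}  {rim j}  eq with ψ-injective {i} {j} eq
      ... | refl = linked-refl _

    private
      ψ-permutes : map ψ (allFin N) ↭ allFin N
      ψ-permutes = ∼bag⇒↭ (unique∧set⇒bag
        (map⁺ (λ {i} {j} → ψ-injective {i} {j}) (allFin⁺ N)) (allFin⁺ N)
        (λ {j} → mk⇔ (λ _ → ∈-allFin j)
             (λ _ → subst (_∈ˡ map ψ (allFin N)) (ψ∘ψ⁻¹ j) (∈-map⁺ ψ (∈-allFin (ψ⁻¹ j))))))

      relabel : ∀ (f : Fin N → Fin N × Fin N) {g} →
                (∀ i → Product.map unroll unroll (g i) ≡ f (ψ i)) →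
                mapEdges unroll (map g (allFin N)) ↭ tabulate f
      relabel f eq = ↭-trans
        (↭-reflexive (trans (sym (map-∘ (allFin N)))
          (trans (map-cong eq (allFin N)) (map-∘ (allFin N)))))
        (↭-trans (map-↭ f ψ-permutes) (↭-reflexive (map-tabulate id f)))

    unroll-wheel : mapEdges unroll (Multigraph.edges (wheel N)) ↭
                   tabulate (λ j → j , next j) ++ tabulate (λ j → zero , j)
    unroll-wheel = ↭-trans
      (↭-reflexive (map-++ _ (map (λ i → rim i , rim (next i)) (allFin N)) _))
      (++⁺ (relabel (λ j → j , next j) λ i → cong (ψ i ,_) (rotate-next _ i)) (relabel (zero ,_) λ _ → refl))

counts-wheel : ∀ k (a : Fin (2 + k)) →
  Counts (λ L → IsTree ((centre , rim a) ∷ L))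
         (Multigraph.edges (wheel (2 + k))) (fib (2 * (2 + k)))
counts-wheel k a = to (counts-contract (unroll-contracts a) _)
  (counts-resp-↭ tree-resp-↭ (↭-sym spread)
    (subst (Counts IsTree ((0F , 0F) ∷ (0F , 1F) ∷ (0F , 1F) ∷ fan k) ∘ fib) (*-comm (2 + k) 2)
      (counts-loop (counts-two-spokes∷fan k))))
  where
  -- The spoke of `a` becomes the loop at 0. The rim edge leaving `a` becomes a second spoke at 1,
  -- and the rim edge entering `a` is the last rim edge of the fan.
  spread : mapEdges (unroll a) (Multigraph.edges (wheel (2 + k))) ↭
           (0F , 0F) ∷ (0F , 1F) ∷ (0F , 1F) ∷ fan k
  spread = ↭-trans (unroll-wheel a)
    (↭-trans (shift (0F , 0F) ((0F , 1F) ∷ rims k) _)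
      (prep _ (prep _ (shift (0F , 1F) (rims k) (spokes k)))))

corollary3p4 : (N : ℕ) → 3 ≤ N → (a : Fin N) →
    𝓕 (wheel N) (centre ∷ rim a ∷ []) ≡ τ (wheel N / (centre ∷ rim a ∷ []))
    × τ (wheel N / (centre ∷ rim a ∷ [])) ≡ fib (2 * N)
corollary3p4 (suc zero) (s≤s ()) _
corollary3p4 N@(suc (suc k)) _ a = trans forests (sym trees) , trees
  where
  centre≢rim : centre ≢ rim a
  centre≢rim ()

  forests : 𝓕 (wheel N) (centre ∷ rim a ∷ []) ≡ fib (2 * N)
  forests = 𝓕-counted (wheel N) centre≢rim (counts-wheel k a)

  trees : τ (wheel N / (centre ∷ rim a ∷ [])) ≡ fib (2 * N)
  trees = τ-merged-counted (wheel N) centre≢rim (counts-wheel k a)
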